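{- Let $G=(I\uplus S\uplus O,E)$ be an $(n,p)$-balancer. Then \[|S|\ \ge\ \frac14\,|I|\,|O|\sum_{k\in\mathbb{N}}\frac{k}{2^k}\,b_k\!\left(\frac{1}{|O|}\right),\] where $b_k(x)\in\{0,1\}$ denotes the digit of weight $2^{ -k}$ in the binary expansion of $x\in[0,1]$.
   Context: A splitter network is a finite directed graph $G$ (loops and parallel arcs allowed) with arc set $E$ whose vertex set is partitioned as $I\uplus S\uplus O$, where each input $i\in I$ has out-degree $1$ and in-degree $0$, each output $o\in O$ has in-degree $1$ and out-degree $0$, and each splitter $s\in S$ has in-degree $2$ and out-degree $2$. $\delta^+(v),\delta^-(v)$ denote outgoing/incoming arcs of $v$, and $\delta^-(O)$ the set of arcs entering outputs. A capacity function is a map $c:I\cup O\to[0,1]$. A steady-state for $(G,c)$ is a pair $(t,F)$ with $t:E\to[0,1]$ and $F\subseteq E$ (fluid arcs; arcs of $E\setminus F$ are saturated) such that: (R3) for each input $i$ with $\delta^+(i)=\{e\}$, $t(e)\le c(i)$, and if $e\in F$ then $t(e)=c(i)$; (R4) for each output $o$ with $\delta^-(o)=\{e\}$, $t(e)\le c(o)$, and if $e\notin F$ then $t(e)=c(o)$; (R5) for each splitter $s$, $t(\delta^-(s))=t(\delta^+(s))$; (R6) for each splitter $s$ with $\delta^-(s)=\{e_1,e_2\}$ and $e_1\notin F$, $t(e_1)\ge t(e_2)$; (R7) for each splitter $s$ with $\delta^+(s)=\{e_1,e_2\}$ and $e_1\in F$, $t(e_1)\ge t(e_2)$; (R8) for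 any arcs $uv\in E\setminus F$ and $vw\in F$, $t(uv)=1$ or $t(vw)=1$. A splitter network is a balancer if for every capacity function $c$ with $c(o)=1$ for all $o\in O$ there is a steady-state $(t,F)$ for $(G,c)$ with $t$ constant on $\delta^-(O)$. An $(n,p)$-balancer is a balancer with $|I|=n$ and $|O|=p$.
   Formalization: Capacities c and throughputs t take rational values in [0,1] instead of real ones: a balancer is required to have, for every rational capacity function with c = 1 on outputs, a rational steady-state constant on the arcs entering outputs. -}

module Defs where

open import Data.Nat as ℕ using (ℕ; zero; suc)
open import Data.Nat.DivMod using (_/_; _%_)
open import Data.Fin using (Fin; zero; suc)
import Data.Fin.Properties as FinP
open import Data.Sum using (_⊎_; inj₁; inj₂)
import Data.Sum.Properties as SumP
open import Data.Product using (Σ; _×_; _,_; ∃)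
open import Data.Bool using (Bool; true; false)
open import Data.Integer using (+_)
open import Data.Rational using (ℚ; 0ℚ; 1ℚ; ½; _+_; _*_; _≤_)
import Data.Rational as ℚ
open import Relation.Nullary using (Dec; yes; no; ¬_)
open import Relation.Binary.PropositionalEquality using (_≡_)
open import Relation.Binary.Definitions using (DecidableEquality)

sumℕ : (n : ℕ) → (Fin n → ℕ) → ℕ
sumℕ zero    f = 0
sumℕ (suc n) f = f zero ℕ.+ sumℕ n (λ i → f (suc i))

sumℚ : (n : ℕ) → (Fin n → ℚ) → ℚ
sumℚ zero    f = 0ℚ
sumℚ (suc n) f = f zero + sumℚ n (λ i → f (suc i))

ℕ→ℚ : ℕ → ℚ
ℕ→ℚ n = (+ n) ℚ./ 1

Vertex : ℕ → ℕ → ℕ → Set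
Vertex nI nS nO = Fin nI ⊎ (Fin nS ⊎ Fin nO)

input : ∀ {nI nS nO} → Fin nI → Vertex nI nS nO
input i = inj₁ i

splitter : ∀ {nI nS nO} → Fin nS → Vertex nI nS nO
splitter s = inj₂ (inj₁ s)

output : ∀ {nI nS nO} → Fin nO → Vertex nI nS nO
output o = inj₂ (inj₂ o)

_≟V_ : ∀ {nI nS nO} → DecidableEquality (Vertex nI nS nO)
_≟V_ = SumP.≡-dec FinP._≟_ (SumP.≡-dec FinP._≟_ FinP._≟_)

record Digraph (nI nS nO : ℕ) : Set where
  field
    nE   : ℕ
    tail : Fin nE → Vertex nI nS nO
    head : Fin nE → Vertex nI nS nO

  Arc : Set
  Arc = Fin nE

  outdeg : Vertex nI nS nO → ℕ
  outdeg v = sumℕ nE (λ e → Dec-ind (tail e ≟V v))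
    where
    Dec-ind : ∀ {A : Set} → Dec A → ℕ
    Dec-ind (yes _) = 1
    Dec-ind (no _)  = 0

  indeg : Vertex nI nS nO → ℕ
  indeg v = sumℕ nE (λ e → Dec-ind (head e ≟V v))
    where
    Dec-ind : ∀ {A : Set} → Dec A → ℕ
    Dec-ind (yes _) = 1
    Dec-ind (no _)  = 0

  inflow : (Arc → ℚ) → Vertex nI nS nO → ℚ
  inflow t v = sumℚ nE (λ e → sel (head e ≟V v) (t e))
    where
    sel : ∀ {A : Set} → Dec A → ℚ → ℚ
    sel (yes _) q = q
    sel (no _)  _ = 0ℚ

  outflow : (Arc → ℚ) → Vertex nI nS nO → ℚ
  outflow t v = sumℚ nE (λ e → sel (tail e ≟V v) (t e))
    where
    sel : ∀ {A : Set} → Dec A → ℚ → ℚ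
    sel (yes _) q = q
    sel (no _)  _ = 0ℚ

IsSplitterNetwork : ∀ {nI nS nO} → Digraph nI nS nO → Set
IsSplitterNetwork {nI} {nS} {nO} G =
    ((i : Fin nI) → outdeg (input i) ≡ 1 × indeg (input i) ≡ 0)
  × ((s : Fin nS) → indeg (splitter s) ≡ 2 × outdeg (splitter s) ≡ 2)
  × ((o : Fin nO) → indeg (output o) ≡ 1 × outdeg (output o) ≡ 0)
  where open Digraph G

-- Steady states.  Capacities cI on inputs, cO on outputs (values in [0,1]);
-- t : E → [0,1]; F ⊆ E given by its indicator (F e ≡ true ⇔ e fluid).

InUnit : ℚ → Set
InUnit q = 0ℚ ≤ q × q ≤ 1ℚ

module _ {nI nS nO : ℕ} (G : Digraph nI nS nO) where
  open Digraph G

  IsSteadyState : (cI : Fin nI → ℚ) (cO : Fin nO → ℚ)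
                  (t : Arc → ℚ) (F : Arc → Bool) → Set
  IsSteadyState cI cO t F =
      ((e : Arc) → InUnit (t e))
    × ((i : Fin nI) (e : Arc) → tail e ≡ input i →
         t e ≤ cI i × (F e ≡ true → t e ≡ cI i))
    × ((o : Fin nO) (e : Arc) → head e ≡ output o →
         t e ≤ cO o × (F e ≡ false → t e ≡ cO o))
    × ((s : Fin nS) → inflow t (splitter s) ≡ outflow t (splitter s))
    × ((s : Fin nS) (e₁ e₂ : Arc) → ¬ (e₁ ≡ e₂) →
         head e₁ ≡ splitter s → head e₂ ≡ splitter s →
         F e₁ ≡ false → t e₂ ≤ t e₁)
    × ((s : Fin nS) (e₁ e₂ : Arc) → ¬ (e₁ ≡ e₂) →
         tail e₁ ≡ splitter s → tail e₂ ≡ splitter s →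
         F e₁ ≡ true → t e₂ ≤ t e₁)
    × ((e₁ e₂ : Arc) → head e₁ ≡ tail e₂ →
         F e₁ ≡ false → F e₂ ≡ true → t e₁ ≡ 1ℚ ⊎ t e₂ ≡ 1ℚ)

  ConstantOnOutputs : (Arc → ℚ) → Set
  ConstantOnOutputs t =
    (o o′ : Fin nO) (e e′ : Arc) → head e ≡ output o → head e′ ≡ output o′ →
    t e ≡ t e′

  IsBalancer : Set
  IsBalancer =
    (cI : Fin nI → ℚ) → ((i : Fin nI) → InUnit (cI i)) →
    Σ (Arc → ℚ) λ t → Σ (Arc → Bool) λ F →
      IsSteadyState cI (λ _ → 1ℚ) t F × ConstantOnOutputs t

-- b_k(1/p): the digit of weight 2^{-k} of 1/p, i.e. ⌊2^k / p⌋ mod 2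
-- (terminating expansion for dyadic 1/p).  For p = 0 (which forces
-- n = 0 and makes the bound trivial) we set it to 0.
digitInv : ℕ → ℕ → ℕ
digitInv zero    k = 0
digitInv (suc q) k = ((2 ℕ.^ k) / suc q) % 2

halfPow : ℕ → ℚ
halfPow zero    = 1ℚ
halfPow (suc k) = ½ * halfPow k

partialSeries : (p N : ℕ) → ℚ
partialSeries p N =
  sumℚ (suc N) (λ k → ℕ→ℚ (Data.Fin.toℕ k ℕ.* digitInv p (Data.Fin.toℕ k)) * halfPow (Data.Fin.toℕ k))

{-# OPTIONS --safe #-}

-- Feed a half-unit pulse into a single input. In a steady state a cut argument
-- isolates a part of the network containing all terminals on which every arc is
-- fluid and every splitter halves its inflow, so the throughput dominates half
-- the expected number of traversals of each arc by the walk that enters at this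
-- input and flips a fair coin at every splitter. Hence this walk reaches each of
-- the p outputs with probability at most 1/p. The probability of having reached
-- a given output after k flips is a multiple of 2⁻ᵏ, hence at most ⌊2ᵏ/p⌋/2ᵏ, so
-- (as in Knuth and Yao's analysis of coin-flipping samplers) the walk is still
-- running after k flips with probability at least (2ᵏ mod p)/2ᵏ. Summing over k
-- gives at least p Σ k bₖ(1/p)/2ᵏ expected splitter visits per input. On the
-- other hand, when one walk starts at every input, the expected number of traversals of
-- each arc is at most 2, so there are at most 4|S| expected visits in total.
module Submission where

open import Defs
open import Algebra.Bundles using (CommutativeMonoid)
open import Algebra.Core using (Op₂)
import Algebra.Properties.Group as Group
open import Algebra.Structures using (IsCommutativeMonoid)
open import Data.Bool using (Bool; true; false; if_then_else_)
import Data.Bool.Properties as Bool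
open import Data.Fin as Fin using (Fin; zero; suc; toℕ; fromℕ; inject₁)
import Data.Fin.Properties as Fin
import Data.Integer as ℤ
import Data.Integer.Properties as ℤ
open import Data.Nat as ℕ using (ℕ; zero; suc; _^_)
open import Data.Nat.Coprimality using (1-coprimeTo) renaming (sym to coprime-sym)
open import Data.Nat.DivMod
import Data.Nat.Properties as ℕ
open import Data.Nat.Solver using (module +-*-Solver)
open import Data.Product using (Σ; _×_; _,_; proj₁; proj₂; ∃)
open import Data.Rational using (ℚ; mkℚ; 0ℚ; 1ℚ; ½; *≤*; _+_; _*_; _≤_; _<_; _-_)
import Data.Rational as ℚ
import Data.Rational.Properties as ℚ
import Data.Rational.Solver as ℚ
open import Data.Sum using (inj₁; inj₂)
open import Function using (_∘_; const)
open import Relation.Binary.PropositionalEquality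
open import Relation.Nullary using (Dec; yes; no; does; ¬_; contradiction)
open import Relation.Nullary.Decidable using (_×-dec_; from-yes)

-- Finite sums in a commutative monoid, and sums over the arcs at a vertex.

module FiniteSum {A : Set} {_∙_ : Op₂ A} {ε : A} (isCM : IsCommutativeMonoid _≡_ _∙_ ε) where

  monoid : CommutativeMonoid _ _
  monoid = record { isCommutativeMonoid = isCM }

  open ≡-Reasoning
  open CommutativeMonoid monoid public using (identityˡ; identityʳ)
  import Algebra.Properties.CommutativeMonoid.Sum monoid as Sum
  open import Algebra.Properties.Monoid.Mult (CommutativeMonoid.monoid monoid) public
    using (×-homo-+) renaming (_×_ to _·_)

  -- Opaque, so that the length of a sum can be inferred by unification.
  opaque

    sum : ∀ {n} → (Fin n → A) → A
    sum = Sum.sum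

    sum-cong : ∀ {n} {f g : Fin n → A} → (∀ i → f i ≡ g i) → sum f ≡ sum g
    sum-cong = Sum.sum-cong-≗

    sum-∙ : ∀ {n} (f g : Fin n → A) → sum (λ i → f i ∙ g i) ≡ sum f ∙ sum g
    sum-∙ = Sum.∑-distrib-+

    sum-comm : ∀ {m n} (f : Fin m → Fin n → A) →
               sum (λ i → sum (f i)) ≡ sum (λ j → sum (λ i → f i j))
    sum-comm = Sum.∑-comm

    sum-const : ∀ {n} x → sum {n} (const x) ≡ n · x
    sum-const {n} x = Sum.sum-replicate n

    sum-ε : ∀ {n} {f : Fin n → A} → (∀ i → f i ≡ ε) → sum f ≡ ε
    sum-ε {n} f≡ε = trans (sum-cong f≡ε) (Sum.sum-replicate-zero n)

    sum-suc : ∀ {n} (f : Fin (suc n) → A) → sum f ≡ f zero ∙ sum (f ∘ suc)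
    sum-suc f = refl

    sum-last : ∀ {n} (f : Fin (suc n) → A) → sum f ≡ sum (f ∘ inject₁) ∙ f (fromℕ n)
    sum-last = Sum.sum-init-last

  when : {P : Set} → Dec P → A → A
  when d x = if does d then x else ε

  when-true : ∀ {P : Set} (d : Dec P) {x} → P → when d x ≡ x
  when-true (yes _)  _ = refl
  when-true (no ¬p) p  = contradiction p ¬p

  when-cong : ∀ {P : Set} (d : Dec P) {x y} → (P → x ≡ y) → when d x ≡ when d y
  when-cong (yes p) x≡y = x≡y p
  when-cong (no _)  _   = refl

  when-∙ : ∀ {P : Set} (d : Dec P) x y → when d (x ∙ y) ≡ when d x ∙ when d y
  when-∙ (yes _) x y = refl
  when-∙ (no _)  x y = sym (identityˡ ε)

  when-sum : ∀ {P : Set} (d : Dec P) {n} (f : Fin n → A) →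
             when d (sum f) ≡ sum (λ i → when d (f i))
  when-sum (yes _) f = refl
  when-sum (no _)  f = sym (sum-ε (λ _ → refl))

  sum-when-≟ : ∀ {n} (i : Fin n) x → sum (λ j → when (i Fin.≟ j) x) ≡ x
  sum-when-≟ zero x = begin
    _      ≡⟨ sum-suc _ ⟩
    x ∙ _  ≡⟨ cong (x ∙_) (sum-ε (λ _ → refl)) ⟩
    x ∙ ε  ≡⟨ identityʳ x ⟩
    x      ∎
  sum-when-≟ (suc i) x = begin
    _      ≡⟨ sum-suc _ ⟩
    ε ∙ _  ≡⟨ identityˡ _ ⟩
    _      ≡⟨ sum-when-≟ i x ⟩
    x      ∎

  module Flow {nI nS nO : ℕ} {nE : ℕ} (end : Fin nE → Vertex nI nS nO) where

    flow : (Fin nE → A) → Vertex nI nS nO → A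
    flow f v = sum (λ e → when (end e ≟V v) (f e))

    sumV : (Vertex nI nS nO → A) → A
    sumV f = sum (f ∘ input) ∙ (sum (f ∘ splitter) ∙ sum (f ∘ output))

    sumV-cong : ∀ {f g : Vertex nI nS nO → A} → (∀ v → f v ≡ g v) → sumV f ≡ sumV g
    sumV-cong f≡g = cong₂ _∙_ (sum-cong (f≡g ∘ input))
      (cong₂ _∙_ (sum-cong (f≡g ∘ splitter)) (sum-cong (f≡g ∘ output)))

    sumV-when-≟ : ∀ u x → sumV (λ v → when (u ≟V v) x) ≡ x
    sumV-when-≟ (inj₁ i) x = begin
      _              ≡⟨ cong₂ _∙_ (sum-when-≟ i x) (cong₂ _∙_ (sum-ε λ _ → refl) (sum-ε λ _ → refl)) ⟩
      x ∙ (ε ∙ ε)    ≡⟨ cong (x ∙_) (identityˡ ε) ⟩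
      x ∙ ε          ≡⟨ identityʳ x ⟩
      x              ∎
    sumV-when-≟ (inj₂ (inj₁ s)) x = begin
      _              ≡⟨ cong₂ _∙_ (sum-ε λ _ → refl) (cong₂ _∙_ (sum-when-≟ s x) (sum-ε λ _ → refl)) ⟩
      ε ∙ (x ∙ ε)    ≡⟨ identityˡ _ ⟩
      x ∙ ε          ≡⟨ identityʳ x ⟩
      x              ∎
    sumV-when-≟ (inj₂ (inj₂ o)) x = begin
      _              ≡⟨ cong₂ _∙_ (sum-ε λ _ → refl) (cong₂ _∙_ (sum-ε λ _ → refl) (sum-when-≟ o x)) ⟩
      ε ∙ (ε ∙ x)    ≡⟨ identityˡ _ ⟩
      ε ∙ x          ≡⟨ identityˡ x ⟩
      x              ∎

    -- Every arc has exactly one `end`, so exchanging sums groups the arcs by vertex. Used for both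
    -- `head` and `tail`, this turns conditions at vertices into global balances.
    handshake : ∀ f → sum f ≡ sumV (flow f)
    handshake f = begin
      sum f
        ≡⟨ sum-cong (λ e → sumV-when-≟ (end e) (f e)) ⟨
      sum (λ e → sumV (λ v → when (end e ≟V v) (f e)))
        ≡⟨ trans (sum-∙ _ _) (cong₂ _∙_ refl (sum-∙ _ _)) ⟩
      _
        ≡⟨ cong₂ _∙_ (sum-comm _) (cong₂ _∙_ (sum-comm _) (sum-comm _)) ⟩
      sumV (flow f) ∎

    flow-cong : ∀ {f g} v → (∀ e → end e ≡ v → f e ≡ g e) → flow f v ≡ flow g v
    flow-cong v f≡g = sum-cong (λ e → when-cong (end e ≟V v) (f≡g e))

    flow-∙ : ∀ f g v → flow (λ e → f e ∙ g e) v ≡ flow f v ∙ flow g v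
    flow-∙ f g v = trans (sum-cong (λ e → when-∙ (end e ≟V v) (f e) (g e))) (sum-∙ _ _)

    flow-sum : ∀ {n} (f : Fin n → Fin nE → A) v →
               flow (λ e → sum (λ i → f i e)) v ≡ sum (λ i → flow (f i) v)
    flow-sum f v = trans (sum-cong (λ e → when-sum (end e ≟V v) (λ i → f i e))) (sum-comm _)

    flow-unless : ∀ (b : Vertex nI nS nO → Bool) f v →
                  flow (λ e → if b (end e) then ε else f e) v ≡ (if b v then ε else flow f v)
    flow-unless b f v = trans (flow-cong v (λ e → cong (λ u → if b u then ε else f e))) (at (b v))
      where
      at : ∀ c → flow (λ e → if c then ε else f e) v ≡ (if c then ε else flow f v)
      at true  = sum-ε λ e → Bool.if-eta (does (end e ≟V v))
      at false = refl

  module Monotone {_≲_ : A → A → Set} (≲-refl : ∀ {x} → x ≲ x)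
                  (∙-mono : ∀ {x y u v} → x ≲ y → u ≲ v → (x ∙ u) ≲ (y ∙ v)) where

    opaque
      unfolding sum

      sum-mono : ∀ {n} {f g : Fin n → A} → (∀ i → f i ≲ g i) → sum f ≲ sum g
      sum-mono {zero}  f≲g = ≲-refl
      sum-mono {suc n} f≲g = ∙-mono (f≲g zero) (sum-mono (f≲g ∘ suc))

    when-mono : ∀ {P : Set} (d : Dec P) {x y} → (P → x ≲ y) → when d x ≲ when d y
    when-mono (yes p) x≲y = x≲y p
    when-mono (no _)  _   = ≲-refl

    flow-mono : ∀ {nI nS nO nE} (end : Fin nE → Vertex nI nS nO) {f g} v → let open Flow end in
                (∀ e → end e ≡ v → f e ≲ g e) → flow f v ≲ flow g v
    flow-mono end v f≲g = sum-mono (λ e → when-mono (end e ≟V v) (f≲g e))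

module Sumℕ where
  open FiniteSum ℕ.+-0-isCommutativeMonoid public
  open Monotone {ℕ._≤_} ℕ.≤-refl ℕ.+-mono-≤ public

module Sumℚ where
  open FiniteSum ℚ.+-0-isCommutativeMonoid public
  open Monotone {_≤_} ℚ.≤-refl ℚ.+-mono-≤ public

open Sumℕ using () renaming (_·_ to _·ℕ_)
open Sumℚ using () renaming (_·_ to _·ℚ_)

-- Degrees, and agreement with the sums in the definitions.

degree : ∀ {nI nS nO nE} → (Fin nE → Vertex nI nS nO) → Vertex nI nS nO → ℕ
degree end = Sumℕ.Flow.flow end (const 1)

opaque
  unfolding Sumℕ.sum

  sumℕ≡sum : ∀ n f → sumℕ n f ≡ Sumℕ.sum f
  sumℕ≡sum zero    f = refl
  sumℕ≡sum (suc n) f = cong (f zero ℕ.+_) (sumℕ≡sum n (f ∘ suc))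

opaque
  unfolding Sumℚ.sum

  sumℚ≡sum : ∀ n f → sumℚ n f ≡ Sumℚ.sum f
  sumℚ≡sum zero    f = refl
  sumℚ≡sum (suc n) f = cong (f zero +_) (sumℚ≡sum n (f ∘ suc))

module _ {nI nS nO} (G : Digraph nI nS nO) where
  open Digraph G

  -- The summands in Defs go through local functions that cannot be named; unification recovers them.
  indeg-summand : ∀ v → Σ (Arc → ℕ) λ f → indeg v ≡ sumℕ nE f
  indeg-summand v = _ , refl

  outdeg-summand : ∀ v → Σ (Arc → ℕ) λ f → outdeg v ≡ sumℕ nE f
  outdeg-summand v = _ , refl

  inflow-summand : ∀ t v → Σ (Arc → ℚ) λ f → inflow t v ≡ sumℚ nE f
  inflow-summand t v = _ , refl

  outflow-summand : ∀ t v → Σ (Arc → ℚ) λ f → outflow t v ≡ sumℚ nE f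
  outflow-summand t v = _ , refl

  indeg≡degree : ∀ v → indeg v ≡ degree head v
  indeg≡degree v = trans (sumℕ≡sum nE _) (Sumℕ.sum-cong summand)
    where
    summand : ∀ e → proj₁ (indeg-summand v) e ≡ Sumℕ.when (head e ≟V v) 1
    summand e with head e ≟V v
    ... | yes _ = refl
    ... | no  _ = refl

  outdeg≡degree : ∀ v → outdeg v ≡ degree tail v
  outdeg≡degree v = trans (sumℕ≡sum nE _) (Sumℕ.sum-cong summand)
    where
    summand : ∀ e → proj₁ (outdeg-summand v) e ≡ Sumℕ.when (tail e ≟V v) 1
    summand e with tail e ≟V v
    ... | yes _ = refl
    ... | no  _ = refl

  inflow≡flow : ∀ t v → inflow t v ≡ Sumℚ.Flow.flow head t v
  inflow≡flow t v = trans (sumℚ≡sum nE _) (Sumℚ.sum-cong summand)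
    where
    summand : ∀ e → proj₁ (inflow-summand t v) e ≡ Sumℚ.when (head e ≟V v) (t e)
    summand e with head e ≟V v
    ... | yes _ = refl
    ... | no  _ = refl

  outflow≡flow : ∀ t v → outflow t v ≡ Sumℚ.Flow.flow tail t v
  outflow≡flow t v = trans (sumℚ≡sum nE _) (Sumℚ.sum-cong summand)
    where
    summand : ∀ e → proj₁ (outflow-summand t v) e ≡ Sumℚ.when (tail e ≟V v) (t e)
    summand e with tail e ≟V v
    ... | yes _ = refl
    ... | no  _ = refl

-- The embedding of naturals into rationals.

ℕ→ℚ≡mkℚ : ∀ n → ℕ→ℚ n ≡ mkℚ (ℤ.+ n) 0 (coprime-sym (1-coprimeTo n))
ℕ→ℚ≡mkℚ n = ℚ.normalize-coprime (coprime-sym (1-coprimeTo n))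

ℕ→ℚ-+ : ∀ m n → ℕ→ℚ (m ℕ.+ n) ≡ ℕ→ℚ m + ℕ→ℚ n
ℕ→ℚ-+ m n = begin
  (ℤ.+ (m ℕ.+ n)) ℚ./ 1
    ≡⟨ cong (ℚ._/ 1) (cong₂ ℤ._+_ (ℤ.*-identityʳ (ℤ.+ m)) (ℤ.*-identityʳ (ℤ.+ n))) ⟨
  (ℤ.+ m ℤ.* ℤ.+ 1 ℤ.+ ℤ.+ n ℤ.* ℤ.+ 1) ℚ./ 1
    ≡⟨ cong₂ _+_ (ℕ→ℚ≡mkℚ m) (ℕ→ℚ≡mkℚ n) ⟨
  ℕ→ℚ m + ℕ→ℚ n ∎
  where open ≡-Reasoning

ℕ→ℚ-* : ∀ m n → ℕ→ℚ (m ℕ.* n) ≡ ℕ→ℚ m * ℕ→ℚ n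
ℕ→ℚ-* m n = begin
  (ℤ.+ (m ℕ.* n)) ℚ./ 1      ≡⟨ cong (ℚ._/ 1) (ℤ.pos-* m n) ⟩
  (ℤ.+ m ℤ.* ℤ.+ n) ℚ./ 1    ≡⟨ cong₂ _*_ (ℕ→ℚ≡mkℚ m) (ℕ→ℚ≡mkℚ n) ⟨
  ℕ→ℚ m * ℕ→ℚ n              ∎
  where open ≡-Reasoning

ℕ→ℚ-mono-≤ : ∀ {m n} → m ℕ.≤ n → ℕ→ℚ m ≤ ℕ→ℚ n
ℕ→ℚ-mono-≤ {m} {n} m≤n rewrite ℕ→ℚ≡mkℚ m | ℕ→ℚ≡mkℚ n =
  *≤* (ℤ.*-monoʳ-≤-nonNeg (ℤ.+ 1) (ℤ.+≤+ m≤n))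

ℕ→ℚ-cancel-≤ : ∀ {m n} → ℕ→ℚ m ≤ ℕ→ℚ n → m ℕ.≤ n
ℕ→ℚ-cancel-≤ {m} {n} m≤n rewrite ℕ→ℚ≡mkℚ m | ℕ→ℚ≡mkℚ n with m≤n
... | *≤* m1≤n1 = ℤ.drop‿+≤+ (ℤ.*-cancelʳ-≤-pos (ℤ.+ m) (ℤ.+ n) (ℤ.+ 1) m1≤n1)

ℕ→ℚ-nonNeg : ∀ n → ℚ.NonNegative (ℕ→ℚ n)
ℕ→ℚ-nonNeg n = ℚ.nonNegative (ℕ→ℚ-mono-≤ {0} {n} ℕ.z≤n)

-- Powers of one half and the partial series without denominators.

2^n*½^n≡1 : ∀ n → ℕ→ℚ (2 ^ n) * halfPow n ≡ 1ℚ
2^n*½^n≡1 zero = refl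
2^n*½^n≡1 (suc n) = begin
  ℕ→ℚ (2 ℕ.* 2 ^ n) * (½ * halfPow n)          ≡⟨ cong (_* (½ * halfPow n)) (ℕ→ℚ-* 2 (2 ^ n)) ⟩
  (ℕ→ℚ 2 * ℕ→ℚ (2 ^ n)) * (½ * halfPow n)
    ≡⟨ solve 4 (λ a b c d → (a :* b) :* (c :* d) := (a :* c) :* (b :* d)) refl (ℕ→ℚ 2) (ℕ→ℚ (2 ^ n)) ½ (halfPow n) ⟩
  (ℕ→ℚ 2 * ½) * (ℕ→ℚ (2 ^ n) * halfPow n)      ≡⟨ cong (1ℚ *_) (2^n*½^n≡1 n) ⟩
  1ℚ                                             ∎
  where
  open ≡-Reasoning
  open ℚ.+-*-Solver

halfPow-nonNeg : ∀ n → ℚ.NonNegative (halfPow n)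
halfPow-nonNeg zero    = _
halfPow-nonNeg (suc n) = ℚ.nonNeg*nonNeg⇒nonNeg ½ (halfPow n) {{halfPow-nonNeg n}}

-- This is 2^k times `partialSeries p k`, an integer, so that the counting can run in `ℕ`. The term
-- of index 0 vanishes, hence the start at 0.
scaledSeries : ℕ → ℕ → ℕ
scaledSeries p zero    = 0
scaledSeries p (suc k) = 2 ℕ.* scaledSeries p k ℕ.+ suc k ℕ.* digitInv p (suc k)

partialSeries-suc : ∀ p k → partialSeries p (suc k) ≡
                    partialSeries p k + ℕ→ℚ (suc k ℕ.* digitInv p (suc k)) * halfPow (suc k)
partialSeries-suc p k = begin
  partialSeries p (suc k)
    ≡⟨ sumℚ≡sum (suc (suc k)) (term ∘ toℕ) ⟩
  Sumℚ.sum (term ∘ toℕ)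
    ≡⟨ Sumℚ.sum-last {suc k} (term ∘ toℕ) ⟩
  Sumℚ.sum (term ∘ toℕ ∘ inject₁) + term (toℕ (fromℕ (suc k)))
    ≡⟨ cong₂ _+_ (Sumℚ.sum-cong {suc k} (cong term ∘ Fin.toℕ-inject₁)) (cong term (Fin.toℕ-fromℕ (suc k))) ⟩
  Sumℚ.sum (term ∘ toℕ) + term (suc k)
    ≡⟨ cong (_+ term (suc k)) (sumℚ≡sum (suc k) (term ∘ toℕ)) ⟨
  partialSeries p k + term (suc k)
    ∎
  where
  open ≡-Reasoning
  term : ℕ → ℚ
  term j = ℕ→ℚ (j ℕ.* digitInv p j) * halfPow j

partialSeries≡scaledSeries : ∀ p k → partialSeries p k ≡ ℕ→ℚ (scaledSeries p k) * halfPow k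
partialSeries≡scaledSeries p zero = refl
partialSeries≡scaledSeries p (suc k) = begin
  partialSeries p (suc k)
    ≡⟨ partialSeries-suc p k ⟩
  partialSeries p k + ℕ→ℚ d * (½ * halfPow k)
    ≡⟨ cong (_+ ℕ→ℚ d * (½ * halfPow k)) (partialSeries≡scaledSeries p k) ⟩
  ℕ→ℚ s * halfPow k + ℕ→ℚ d * (½ * halfPow k)
    ≡⟨ cong (λ h → h + ℕ→ℚ d * (½ * halfPow k)) (ℚ.*-identityˡ (ℕ→ℚ s * halfPow k)) ⟨
  (ℕ→ℚ 2 * ½) * (ℕ→ℚ s * halfPow k) + ℕ→ℚ d * (½ * halfPow k)
    ≡⟨ solve 5 (λ t s d a h → (t :* a) :* (s :* h) :+ d :* (a :* h) := (t :* s :+ d) :* (a :* h))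
         refl (ℕ→ℚ 2) (ℕ→ℚ s) (ℕ→ℚ d) ½ (halfPow k) ⟩
  (ℕ→ℚ 2 * ℕ→ℚ s + ℕ→ℚ d) * (½ * halfPow k)
    ≡⟨ cong (λ x → (x + ℕ→ℚ d) * (½ * halfPow k)) (ℕ→ℚ-* 2 s) ⟨
  (ℕ→ℚ (2 ℕ.* s) + ℕ→ℚ d) * (½ * halfPow k)
    ≡⟨ cong (_* (½ * halfPow k)) (ℕ→ℚ-+ (2 ℕ.* s) d) ⟨
  ℕ→ℚ (scaledSeries p (suc k)) * halfPow (suc k)
    ∎
  where
  open ≡-Reasoning
  open ℚ.+-*-Solver
  s = scaledSeries p k
  d = suc k ℕ.* digitInv p (suc k)

-- Remainders of powers of two and the digits of the reciprocal.

module Remainders (q : ℕ) where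
  open ≡-Reasoning
  private
    p = suc q

  -- For positive k, this is 2^(k-1) times the sum of (2^j mod p)/2^j over j < k, to be compared
  -- with `load`.
  remainderSum : ℕ → ℕ
  remainderSum zero    = 0
  remainderSum (suc k) = 2 ℕ.* remainderSum k ℕ.+ 2 ^ k % p

  -- One step of binary long division: halving the quotient of 2m gives the quotient of m, so
  -- doubling a remainder splits off one digit times p and leaves the next remainder.
  double-remainder : ∀ m → 2 ℕ.* (m % p) ≡ (2 ℕ.* m / p % 2) ℕ.* p ℕ.+ 2 ℕ.* m % p
  double-remainder m = ℕ.+-cancelˡ-≡ (2 ℕ.* (m / p) ℕ.* p) _ _ (begin
    2 ℕ.* (m / p) ℕ.* p ℕ.+ 2 ℕ.* (m % p)
      ≡⟨ solve 3 (λ a b c → con 2 :* a :* b :+ con 2 :* c := con 2 :* (c :+ a :* b)) refl (m / p) p (m % p) ⟩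
    2 ℕ.* (m % p ℕ.+ m / p ℕ.* p)
      ≡⟨ cong (2 ℕ.*_) (m≡m%n+[m/n]*n m p) ⟨
    2 ℕ.* m
      ≡⟨ m≡m%n+[m/n]*n (2 ℕ.* m) p ⟩
    2 ℕ.* m % p ℕ.+ Q ℕ.* p
      ≡⟨ cong (λ x → 2 ℕ.* m % p ℕ.+ x ℕ.* p) (m≡m%n+[m/n]*n Q 2) ⟩
    2 ℕ.* m % p ℕ.+ (Q % 2 ℕ.+ Q / 2 ℕ.* 2) ℕ.* p
      ≡⟨ cong (λ x → 2 ℕ.* m % p ℕ.+ (Q % 2 ℕ.+ x ℕ.* 2) ℕ.* p) halve ⟩
    2 ℕ.* m % p ℕ.+ (Q % 2 ℕ.+ m / p ℕ.* 2) ℕ.* p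
      ≡⟨ solve 4 (λ r b a c → r :+ (b :+ a :* con 2) :* c := con 2 :* a :* c :+ (b :* c :+ r)) refl (2 ℕ.* m % p) (Q % 2) (m / p) p ⟩
    2 ℕ.* (m / p) ℕ.* p ℕ.+ (Q % 2 ℕ.* p ℕ.+ 2 ℕ.* m % p) ∎)
    where
    open +-*-Solver
    Q = 2 ℕ.* m / p
    halve : Q / 2 ≡ m / p
    halve = begin
      2 ℕ.* m / p / 2            ≡⟨ m/n/o≡m/[n*o] (2 ℕ.* m) p 2 ⟩
      2 ℕ.* m / (p ℕ.* 2)        ≡⟨ /-congʳ {m = 2 ℕ.* m} (ℕ.*-comm p 2) ⟩
      2 ℕ.* m / (2 ℕ.* p)        ≡⟨ m*n/m*o≡n/o 2 m p ⟩
      m / p                      ∎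

  -- Summation by parts, since p bₖ₊₁ = 2 (2ᵏ mod p) − (2ᵏ⁺¹ mod p).
  scaledSeries-remainderSum : ∀ k → p ℕ.* scaledSeries p k ℕ.+ k ℕ.* (2 ^ k % p) ≡ 2 ℕ.* remainderSum k
  scaledSeries-remainderSum zero = cong (ℕ._+ 0) (ℕ.*-zeroʳ p)
  scaledSeries-remainderSum (suc k) = begin
    p ℕ.* (2 ℕ.* s ℕ.+ suc k ℕ.* b) ℕ.+ suc k ℕ.* r′
      ≡⟨ solve 5 (λ p s k b r′ → p :* (con 2 :* s :+ (con 1 :+ k) :* b) :+ (con 1 :+ k) :* r′
                              := con 2 :* (p :* s) :+ (con 1 :+ k) :* (b :* p :+ r′)) refl p s k b r′ ⟩
    2 ℕ.* (p ℕ.* s) ℕ.+ suc k ℕ.* (b ℕ.* p ℕ.+ r′)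
      ≡⟨ cong (λ x → 2 ℕ.* (p ℕ.* s) ℕ.+ suc k ℕ.* x) (double-remainder (2 ^ k)) ⟨
    2 ℕ.* (p ℕ.* s) ℕ.+ suc k ℕ.* (2 ℕ.* r)
      ≡⟨ solve 3 (λ x k r → con 2 :* x :+ (con 1 :+ k) :* (con 2 :* r) := con 2 :* ((x :+ k :* r) :+ r)) refl (p ℕ.* s) k r ⟩
    2 ℕ.* ((p ℕ.* s ℕ.+ k ℕ.* r) ℕ.+ r)
      ≡⟨ cong (λ x → 2 ℕ.* (x ℕ.+ r)) (scaledSeries-remainderSum k) ⟩
    2 ℕ.* remainderSum (suc k) ∎
    where
    open +-*-Solver
    s = scaledSeries p k
    b = digitInv p (suc k)
    r = 2 ^ k % p
    r′ = 2 ^ suc k % p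

  -- The boundary term of the summation by parts is nonnegative and is dropped.
  scaledSeries≤2*remainderSum : ∀ k → p ℕ.* scaledSeries p k ℕ.≤ 2 ℕ.* remainderSum k
  scaledSeries≤2*remainderSum k = ℕ.≤-trans (ℕ.m≤m+n _ _) (ℕ.≤-reflexive (scaledSeries-remainderSum k))

-- Tight sums, sums of constants at a vertex, and monoid homomorphisms.

opaque
  unfolding Sumℕ.sum

  term≤sum : ∀ {n} (f : Fin n → ℕ) i → f i ℕ.≤ Sumℕ.sum f
  term≤sum f zero    = ℕ.m≤m+n _ _
  term≤sum f (suc i) = ℕ.m≤n⇒m≤o+n (f zero) (term≤sum (f ∘ suc) i)

opaque
  unfolding Sumℚ.sum

  -- One strict term would make the sums differ. This converts the global balance of slack into a
  -- statement about each arc.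
  sum-tight : ∀ {n} {f g : Fin n → ℚ} → (∀ i → f i ≤ g i) → Sumℚ.sum f ≡ Sumℚ.sum g → ∀ i → f i ≡ g i
  sum-tight {suc n} {f} {g} f≤g Σf≡Σg = λ where
      zero    → f₀≡g₀
      (suc i) → sum-tight (f≤g ∘ suc) tails i
    where
    f₀≡g₀ : f zero ≡ g zero
    f₀≡g₀ = ℚ.≤-antisym (f≤g zero) (ℚ.≮⇒≥ λ f₀<g₀ →
      ℚ.<-irrefl Σf≡Σg (ℚ.+-mono-<-≤ f₀<g₀ (Sumℚ.sum-mono (f≤g ∘ suc))))
    tails : Sumℚ.sum (f ∘ suc) ≡ Sumℚ.sum (g ∘ suc)
    tails = Group.∙-cancelˡ ℚ.+-0-group (f zero) _ _ (trans Σf≡Σg (cong (_+ Sumℚ.sum (g ∘ suc)) (sym f₀≡g₀)))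

degree≡0⇒≢ : ∀ {nI nS nO nE} (end : Fin nE → Vertex nI nS nO) {v} → degree end v ≡ 0 → ∀ e → end e ≢ v
degree≡0⇒≢ end {v} deg≡0 e end≡v = contradiction 1≤0 λ ()
  where
  1≤0 : 1 ℕ.≤ 0
  1≤0 = subst₂ ℕ._≤_ (Sumℕ.when-true (end e ≟V v) end≡v) deg≡0
          (term≤sum (λ e′ → Sumℕ.when (end e′ ≟V v) 1) e)

module DegreeSum {A : Set} {_∙_ : Op₂ A} {ε : A} (isCM : IsCommutativeMonoid _≡_ _∙_ ε) where
  open FiniteSum isCM using (module Flow; when; sum-ε; sum-suc; ×-homo-+; identityʳ) renaming (_·_ to _⊙_)
  open ≡-Reasoning

  flow-const : ∀ {nI nS nO nE} (end : Fin nE → Vertex nI nS nO) c v →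
               Flow.flow end (const c) v ≡ degree end v ⊙ c
  flow-const {nE = zero} end c v = trans (sum-ε λ ()) (cong (_⊙ c) (sym (Sumℕ.sum-ε λ ())))
  flow-const {nE = suc _} end c v = begin
    _ ≡⟨ sum-suc _ ⟩
    _ ≡⟨ cong₂ _∙_ (when-⊙ (end zero ≟V v)) (flow-const (end ∘ suc) c v) ⟩
    _ ≡⟨ ×-homo-+ c (Sumℕ.when (end zero ≟V v) 1) (degree (end ∘ suc) v) ⟨
    _ ≡⟨ cong (_⊙ c) (Sumℕ.sum-suc _) ⟨
    _ ∎
    where
    when-⊙ : ∀ {P : Set} (d : Dec P) → when d c ≡ Sumℕ.when d 1 ⊙ c
    when-⊙ (yes _) = sym (identityʳ c)
    when-⊙ (no _)  = refl

  flow-const-on : ∀ {nI nS nO nE} (end : Fin nE → Vertex nI nS nO) {f c} v →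
                  (∀ e → end e ≡ v → f e ≡ c) → Flow.flow end f v ≡ degree end v ⊙ c
  flow-const-on end {c = c} v f≡c = trans (Flow.flow-cong end v f≡c) (flow-const end c v)

  flow-none : ∀ {nI nS nO nE} (end : Fin nE → Vertex nI nS nO) f {v} →
              degree end v ≡ 0 → Flow.flow end f v ≡ ε
  flow-none end f {v} deg≡0 =
    trans (flow-const-on end {c = ε} v λ e end≡v → contradiction end≡v (degree≡0⇒≢ end deg≡0 e)) (cong (_⊙ ε) deg≡0)

module Degℕ = DegreeSum ℕ.+-0-isCommutativeMonoid
module Degℚ = DegreeSum ℚ.+-0-isCommutativeMonoid

module _ {A B : Set} {_∙_ : Op₂ A} {ε : A} {_∙′_ : Op₂ B} {ε′ : B}
         (isCM : IsCommutativeMonoid _≡_ _∙_ ε) (isCM′ : IsCommutativeMonoid _≡_ _∙′_ ε′)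
         (φ : A → B) (φ-ε : φ ε ≡ ε′) (φ-∙ : ∀ x y → φ (x ∙ y) ≡ φ x ∙′ φ y) where
  private
    module A = FiniteSum isCM
    module B = FiniteSum isCM′

  sum-homo : ∀ {n} (f : Fin n → A) → φ (A.sum f) ≡ B.sum (φ ∘ f)
  sum-homo {zero} f = trans (cong φ (A.sum-ε λ ())) (trans φ-ε (sym (B.sum-ε λ ())))
  sum-homo {suc n} f = begin
    φ (A.sum f)                          ≡⟨ cong φ (A.sum-suc f) ⟩
    φ (f zero ∙ A.sum (f ∘ suc))         ≡⟨ φ-∙ _ _ ⟩
    φ (f zero) ∙′ φ (A.sum (f ∘ suc))    ≡⟨ cong (φ (f zero) ∙′_) (sum-homo (f ∘ suc)) ⟩
    φ (f zero) ∙′ B.sum (φ ∘ f ∘ suc)    ≡⟨ B.sum-suc (φ ∘ f) ⟨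
    B.sum (φ ∘ f)                        ∎
    where open ≡-Reasoning

  when-homo : ∀ {P : Set} (d : Dec P) x → φ (A.when d x) ≡ B.when d (φ x)
  when-homo (yes _) x = refl
  when-homo (no _)  x = φ-ε

  flow-homo : ∀ {nI nS nO nE} (end : Fin nE → Vertex nI nS nO) f v →
              φ (A.Flow.flow end f v) ≡ B.Flow.flow end (φ ∘ f) v
  flow-homo end f v = trans (sum-homo _) (B.sum-cong λ e → when-homo (end e ≟V v) (f e))

·ℕ≡* : ∀ n x → n ·ℕ x ≡ n ℕ.* x
·ℕ≡* zero    x = refl
·ℕ≡* (suc n) x = cong (x ℕ.+_) (·ℕ≡* n x)

·ℚ≡* : ∀ n x → n ·ℚ x ≡ ℕ→ℚ n * x
·ℚ≡* zero    x = sym (ℚ.*-zeroˡ x)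
·ℚ≡* (suc n) x = begin
  x + n ·ℚ x              ≡⟨ cong₂ _+_ (sym (ℚ.*-identityˡ x)) (·ℚ≡* n x) ⟩
  1ℚ * x + ℕ→ℚ n * x      ≡⟨ ℚ.*-distribʳ-+ x 1ℚ (ℕ→ℚ n) ⟨
  (1ℚ + ℕ→ℚ n) * x        ≡⟨ cong (_* x) (ℕ→ℚ-+ 1 n) ⟨
  ℕ→ℚ (suc n) * x         ∎
  where open ≡-Reasoning

-- Scaled traversal counts of the coin-flipping walk.

module Network {nI nS nO} (G : Digraph nI nS nO) (network : IsSplitterNetwork G) where
  open Digraph G

  indegᴵ : ∀ i → degree head (input i) ≡ 0
  indegᴵ i = trans (sym (indeg≡degree G (input i))) (proj₂ (proj₁ network i))

  outdegᴵ : ∀ i → degree tail (input i) ≡ 1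
  outdegᴵ i = trans (sym (outdeg≡degree G (input i))) (proj₁ (proj₁ network i))

  indegˢ : ∀ s → degree head (splitter s) ≡ 2
  indegˢ s = trans (sym (indeg≡degree G (splitter s))) (proj₁ (proj₁ (proj₂ network) s))

  outdegˢ : ∀ s → degree tail (splitter s) ≡ 2
  outdegˢ s = trans (sym (outdeg≡degree G (splitter s))) (proj₂ (proj₁ (proj₂ network) s))

  indegᴼ : ∀ o → degree head (output o) ≡ 1
  indegᴼ o = trans (sym (indeg≡degree G (output o))) (proj₁ (proj₂ (proj₂ network) o))

  outdegᴼ : ∀ o → degree tail (output o) ≡ 0
  outdegᴼ o = trans (sym (outdeg≡degree G (output o))) (proj₂ (proj₂ (proj₂ network) o))

  module Inℕ  = Sumℕ.Flow {nI} {nS} {nO} head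
  module Outℕ = Sumℕ.Flow {nI} {nS} {nO} tail
  module Inℚ  = Sumℚ.Flow {nI} {nS} {nO} head
  module Outℚ = Sumℚ.Flow {nI} {nS} {nO} tail

  -- For the walk entering at input i and leaving every splitter through a fair
  -- coin flip, visits i (suc k) e is 2ᵏ times the expected number of traversals
  -- of e among the first k + 1 arcs.
  visits : Fin nI → ℕ → Arc → ℕ
  visits i zero    e = 0
  visits i (suc k) e = Sumℕ.when (tail e ≟V input i) (2 ^ k) ℕ.+ Inℕ.flow (visits i k) (tail e)

  -- For positive k, this is 2^(k-1) times the expected number of arrivals at splitters among the
  -- first k arcs of the walk.
  load : Fin nI → ℕ → ℕ
  load i k = Sumℕ.sum (λ s → Inℕ.flow (visits i k) (splitter s))

  -- Both sides are 2^k times the expected number of arcs among the first k + 1. By head, each ends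
  -- at a splitter or an output; by tail, it is the first arc or continues an earlier splitter
  -- visit. The factor 2 is the out-degree: at the doubled scale, each outgoing arc receives the
  -- full count of its splitter.
  load-suc : ∀ i k → load i (suc k) ℕ.+ Sumℕ.sum (λ o → Inℕ.flow (visits i (suc k)) (output o))
                     ≡ 2 ^ k ℕ.+ 2 ℕ.* load i k
  load-suc i k = begin
    load i (suc k) ℕ.+ Sumℕ.sum (Inℕ.flow V′ ∘ output)
      ≡⟨ cong (ℕ._+ (load i (suc k) ℕ.+ Sumℕ.sum (Inℕ.flow V′ ∘ output)))
              (Sumℕ.sum-ε λ j → Degℕ.flow-none head V′ (indegᴵ j)) ⟨
    Inℕ.sumV (Inℕ.flow V′)
      ≡⟨ Inℕ.handshake V′ ⟨
    Sumℕ.sum V′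
      ≡⟨ Sumℕ.sum-∙ _ _ ⟩
    Outℕ.flow (const (2 ^ k)) (input i) ℕ.+ Sumℕ.sum (Inℕ.flow V ∘ tail)
      ≡⟨ cong₂ ℕ._+_ source (Outℕ.handshake (Inℕ.flow V ∘ tail)) ⟩
    2 ^ k ℕ.+ Outℕ.sumV (Outℕ.flow (Inℕ.flow V ∘ tail))
      ≡⟨ cong (2 ^ k ℕ.+_) (Outℕ.sumV-cong λ v → Degℕ.flow-const-on tail v λ e → cong (Inℕ.flow V)) ⟩
    2 ^ k ℕ.+ Outℕ.sumV (λ v → degree tail v ·ℕ Inℕ.flow V v)
      ≡⟨ cong (2 ^ k ℕ.+_) (cong₂ ℕ._+_ (Sumℕ.sum-ε atI)
           (cong₂ ℕ._+_ atS (Sumℕ.sum-ε λ o → cong (_·ℕ Inℕ.flow V (output o)) (outdegᴼ o)))) ⟩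
    2 ^ k ℕ.+ (2 ℕ.* load i k ℕ.+ 0)
      ≡⟨ cong (2 ^ k ℕ.+_) (ℕ.+-identityʳ _) ⟩
    2 ^ k ℕ.+ 2 ℕ.* load i k
      ∎
    where
    open ≡-Reasoning
    V = visits i k
    V′ = visits i (suc k)

    source : Outℕ.flow (const (2 ^ k)) (input i) ≡ 2 ^ k
    source = trans (Degℕ.flow-const-on tail (input i) (λ _ _ → refl))
                   (trans (cong (_·ℕ 2 ^ k) (outdegᴵ i)) (ℕ.+-identityʳ _))

    atI : ∀ j → degree tail (input j) ·ℕ Inℕ.flow V (input j) ≡ 0
    atI j = cong₂ _·ℕ_ (outdegᴵ j) (Degℕ.flow-none head V (indegᴵ j))

    atS : Sumℕ.sum (λ s → degree tail (splitter s) ·ℕ Inℕ.flow V (splitter s)) ≡ 2 ℕ.* load i k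
    atS = trans (Sumℕ.sum-cong λ s → trans (cong (_·ℕ Inℕ.flow V (splitter s)) (outdegˢ s)) (·ℕ≡* 2 (Inℕ.flow V (splitter s))))
                (sym (sum-homo ℕ.+-0-isCommutativeMonoid ℕ.+-0-isCommutativeMonoid (2 ℕ.*_) refl (ℕ.*-distribˡ-+ 2) _))

  -- The bound propagates: an input contributes only its source term 2^k, and the two arcs into a
  -- splitter, with at most 2^k each, add up to the next bound. Unscaled, the expectation per arc is
  -- at most 2.
  total-visits : ∀ k e → Sumℕ.sum (λ i → visits i k e) ℕ.≤ 2 ^ k
  total-visits zero e = ℕ.≤-trans (ℕ.≤-reflexive (Sumℕ.sum-ε {nI} λ _ → refl)) ℕ.z≤n
  total-visits (suc k) e = begin
    Sumℕ.sum (λ i → visits i (suc k) e)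
      ≡⟨ Sumℕ.sum-∙ _ _ ⟩
    sources (tail e) ℕ.+ Sumℕ.sum (λ i → Inℕ.flow (visits i k) (tail e))
      ≡⟨ cong (sources (tail e) ℕ.+_) (Inℕ.flow-sum (λ i → visits i k) (tail e)) ⟨
    sources (tail e) ℕ.+ Inℕ.flow (λ e′ → Sumℕ.sum (λ i → visits i k e′)) (tail e)
      ≤⟨ ℕ.+-monoʳ-≤ (sources (tail e)) (Sumℕ.flow-mono head (tail e) (λ e′ _ → total-visits k e′)) ⟩
    sources (tail e) ℕ.+ Inℕ.flow (const (2 ^ k)) (tail e)
      ≡⟨ cong (sources (tail e) ℕ.+_) (Degℕ.flow-const head (2 ^ k) (tail e)) ⟩
    sources (tail e) ℕ.+ degree head (tail e) ·ℕ 2 ^ k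
      ≤⟨ bound (tail e) ⟩
    2 ^ suc k ∎
    where
    open ℕ.≤-Reasoning
    sources : Vertex nI nS nO → ℕ
    sources v = Sumℕ.sum (λ i → Sumℕ.when (v ≟V input i) (2 ^ k))

    bound : ∀ v → sources v ℕ.+ degree head v ·ℕ 2 ^ k ℕ.≤ 2 ^ suc k
    bound (inj₁ j) rewrite indegᴵ j =
      ℕ.+-mono-≤ (ℕ.≤-reflexive (Sumℕ.sum-when-≟ j (2 ^ k))) ℕ.z≤n
    bound (inj₂ (inj₁ s)) rewrite indegˢ s =
      ℕ.+-mono-≤ (ℕ.≤-reflexive (Sumℕ.sum-ε {nI} λ _ → refl)) ℕ.≤-refl
    bound (inj₂ (inj₂ o)) rewrite indegᴼ o =
      ℕ.+-mono-≤ {y = 2 ^ k} (ℕ.≤-trans (ℕ.≤-reflexive (Sumℕ.sum-ε {nI} λ _ → refl)) ℕ.z≤n) ℕ.≤-refl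

  total-load : ∀ k → Sumℕ.sum (λ i → load i k) ℕ.≤ nS ℕ.* 2 ^ suc k
  total-load k = begin
    Sumℕ.sum (λ i → load i k)
      ≡⟨ Sumℕ.sum-comm _ ⟩
    Sumℕ.sum (λ s → Sumℕ.sum (λ i → Inℕ.flow (visits i k) (splitter s)))
      ≤⟨ Sumℕ.sum-mono perSplitter ⟩
    Sumℕ.sum {nS} (const (2 ^ suc k))
      ≡⟨ Sumℕ.sum-const {nS} (2 ^ suc k) ⟩
    nS ·ℕ 2 ^ suc k
      ≡⟨ ·ℕ≡* nS (2 ^ suc k) ⟩
    nS ℕ.* 2 ^ suc k ∎
    where
    open ℕ.≤-Reasoning
    perSplitter : ∀ s → Sumℕ.sum (λ i → Inℕ.flow (visits i k) (splitter s)) ℕ.≤ 2 ^ suc k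
    perSplitter s = begin
      Sumℕ.sum (λ i → Inℕ.flow (visits i k) (splitter s))
        ≡⟨ Inℕ.flow-sum (λ i → visits i k) (splitter s) ⟨
      Inℕ.flow (λ e → Sumℕ.sum (λ i → visits i k e)) (splitter s)
        ≤⟨ Sumℕ.flow-mono head (splitter s) (λ e _ → total-visits k e) ⟩
      Inℕ.flow (const (2 ^ k)) (splitter s)
        ≡⟨ Degℕ.flow-const head (2 ^ k) (splitter s) ⟩
      degree head (splitter s) ·ℕ 2 ^ k
        ≡⟨ cong (_·ℕ 2 ^ k) (indegˢ s) ⟩
      2 ^ suc k ∎


-- The half-unit pulse.

0≤½ : 0ℚ ≤ ½
0≤½ = from-yes (0ℚ ℚ.≤? ½)

½<1 : ½ < 1ℚ
½<1 = from-yes (½ ℚ.<? 1ℚ)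

-- The height is below 1 so that no arc leaving an input is full, as `leaving-core` needs; the value
-- ½ cancels the extra factor 2 in `visits≤coreFlow`.
pulse : ∀ {n} → Fin n → Fin n → ℚ
pulse i j = Sumℚ.when (i Fin.≟ j) ½

0≤pulse : ∀ {n} (i j : Fin n) → 0ℚ ≤ pulse i j
0≤pulse i j with i Fin.≟ j
... | yes _ = 0≤½
... | no  _ = ℚ.≤-refl

pulse≤½ : ∀ {n} (i j : Fin n) → pulse i j ≤ ½
pulse≤½ i j with i Fin.≟ j
... | yes _ = ℚ.≤-refl
... | no  _ = 0≤½

module _ {nI nS nO} (G : Digraph nI nS nO) (network : IsSplitterNetwork G) where
  open Digraph G
  open Network G network

  -- The core of a steady state.

  module Steady (i : Fin nI) {t : Arc → ℚ} {F : Arc → Bool}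
    (steady : IsSteadyState G (pulse i) (λ _ → 1ℚ) t F) where

    0≤t : ∀ e → 0ℚ ≤ t e
    0≤t e = proj₁ (proj₁ steady e)

    t≤1 : ∀ e → t e ≤ 1ℚ
    t≤1 e = proj₂ (proj₁ steady e)

    R3 = proj₁ (proj₂ steady)
    R4 = proj₁ (proj₂ (proj₂ steady))
    R5 = proj₁ (proj₂ (proj₂ (proj₂ steady)))
    R7 = proj₁ (proj₂ (proj₂ (proj₂ (proj₂ (proj₂ steady)))))
    R8 = proj₂ (proj₂ (proj₂ (proj₂ (proj₂ (proj₂ steady)))))

    conserved : ∀ s → Inℚ.flow t (splitter s) ≡ Outℚ.flow t (splitter s)
    conserved s = trans (sym (inflow≡flow G t (splitter s))) (trans (R5 s) (outflow≡flow G t (splitter s)))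

    -- Such a witness arc makes both rules bite: R8 forces saturated arcs into the splitter to be
    -- full, and R7 makes the witness a largest outgoing arc.
    Spare : Fin nS → Set
    Spare s = ∃ λ e → tail e ≡ splitter s × F e ≡ true × t e < 1ℚ

    spare? : ∀ s → Dec (Spare s)
    spare? s = Fin.any? λ e → (tail e ≟V splitter s) ×-dec (F e Bool.≟ true) ×-dec (t e ℚ.<? 1ℚ)

    -- The side of the cut that contains all terminals. Outside lie only splitters whose fluid
    -- outgoing arcs are all full.
    core : Vertex nI nS nO → Bool
    core (inj₁ _)        = true
    core (inj₂ (inj₁ s)) = does (spare? s)
    core (inj₂ (inj₂ _)) = true

    spare : ∀ s → core (splitter s) ≡ true → Spare s
    spare s with spare? s
    ... | yes p = λ _ → p
    ... | no  _ = λ ()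

    no-spare : ∀ s → core (splitter s) ≡ false → ¬ Spare s
    no-spare s with spare? s
    ... | yes _ = λ ()
    ... | no ¬p = λ _ → ¬p

    -- At a spare splitter, R8 is applied against the witness, which is not full; at an output, R4
    -- gives the capacity 1.
    saturated-into-core : ∀ e → core (head e) ≡ true → F e ≡ false → t e ≡ 1ℚ
    saturated-into-core e c f = at (head e) refl
      where
      at : ∀ v → head e ≡ v → t e ≡ 1ℚ
      at (inj₁ j) h = contradiction h (degree≡0⇒≢ head (indegᴵ j) e)
      at (inj₂ (inj₁ s)) h with spare s (trans (cong core (sym h)) c)
      ... | e′ , tail≡s , fluid , t<1 with R8 e e′ (trans h (sym tail≡s)) f fluid
      ...   | inj₁ t≡1  = t≡1
      ...   | inj₂ t′≡1 = contradiction t<1 (ℚ.<-irrefl t′≡1)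
      at (inj₂ (inj₂ o)) h = proj₂ (R4 o e h) f

    -- The tail is a splitter without spare capacity, so a fluid `e` is full; a saturated one is
    -- full by `saturated-into-core`.
    entering-core : ∀ e → core (tail e) ≡ false → core (head e) ≡ true → t e ≡ 1ℚ
    entering-core e c c′ = at (tail e) refl
      where
      at : ∀ v → tail e ≡ v → t e ≡ 1ℚ
      at (inj₁ j) h = contradiction (trans (sym (cong core h)) c) λ ()
      at (inj₂ (inj₁ s)) h with F e in f | t e ℚ.<? 1ℚ
      ... | false | _ = saturated-into-core e c′ f
      ... | true | yes t<1 = contradiction (e , h , f , t<1) (no-spare s (trans (cong core (sym h)) c))
      ... | true | no t≮1 = ℚ.≤-antisym (t≤1 e) (ℚ.≮⇒≥ t≮1)
      at (inj₂ (inj₂ o)) h = contradiction h (degree≡0⇒≢ tail (outdegᴼ o) e)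

    below-fluid : ∀ s e e′ → tail e ≡ splitter s → tail e′ ≡ splitter s → F e ≡ true → t e′ ≤ t e
    below-fluid s e e′ h h′ f with e Fin.≟ e′
    ... | yes refl = ℚ.≤-refl
    ... | no e≢e′  = R7 s e e′ e≢e′ h h′ f

    -- At an input the pulse allows at most ½. At a spare splitter the fluid witness bounds every
    -- outgoing arc by R7 and is itself below 1.
    leaving-core : ∀ e → core (tail e) ≡ true → t e < 1ℚ
    leaving-core e c = at (tail e) refl
      where
      at : ∀ v → tail e ≡ v → t e < 1ℚ
      at (inj₁ j) h = ℚ.≤-<-trans (ℚ.≤-trans (proj₁ (R3 j e h)) (pulse≤½ i j)) ½<1
      at (inj₂ (inj₁ s)) h with spare s (trans (cong core (sym h)) c)
      ... | e′ , h′ , fluid , t<1 = ℚ.≤-<-trans (below-fluid s e′ e h′ h fluid) t<1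
      at (inj₂ (inj₂ o)) h = contradiction h (degree≡0⇒≢ tail (outdegᴼ o) e)

    slack : Arc → ℚ
    slack e = 1ℚ - t e

    slack+t : ∀ e → slack e + t e ≡ 1ℚ
    slack+t e = begin
      (1ℚ - t e) + t e     ≡⟨ ℚ.+-assoc 1ℚ (ℚ.- t e) (t e) ⟩
      1ℚ + (ℚ.- t e + t e) ≡⟨ cong (1ℚ +_) (ℚ.+-inverseˡ (t e)) ⟩
      1ℚ + 0ℚ              ∎
      where open ≡-Reasoning

    -- Conservation of `t` carries over because a splitter has as many incoming as outgoing arcs.
    slack-conserved : ∀ s → Inℚ.flow slack (splitter s) ≡ Outℚ.flow slack (splitter s)
    slack-conserved s = Group.∙-cancelʳ ℚ.+-0-group (Inℚ.flow t (splitter s)) _ _ (begin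
      Inℚ.flow slack (splitter s) + Inℚ.flow t (splitter s)
        ≡⟨ Inℚ.flow-∙ slack t (splitter s) ⟨
      Inℚ.flow (λ e → slack e + t e) (splitter s)
        ≡⟨ Degℚ.flow-const-on head (splitter s) (λ e _ → slack+t e) ⟩
      degree head (splitter s) ·ℚ 1ℚ
        ≡⟨ cong (_·ℚ 1ℚ) (trans (indegˢ s) (sym (outdegˢ s))) ⟩
      degree tail (splitter s) ·ℚ 1ℚ
        ≡⟨ Degℚ.flow-const-on tail (splitter s) (λ e _ → slack+t e) ⟨
      Outℚ.flow (λ e → slack e + t e) (splitter s)
        ≡⟨ Outℚ.flow-∙ slack t (splitter s) ⟩
      Outℚ.flow slack (splitter s) + Outℚ.flow t (splitter s)
        ≡⟨ cong (Outℚ.flow slack (splitter s) +_) (conserved s) ⟨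
      Outℚ.flow slack (splitter s) + Inℚ.flow t (splitter s)
        ∎)
      where open ≡-Reasoning

    -- Arcs entering the core carry no slack, while slack is conserved at the
    -- splitters outside the core; so no slack leaves the core either.
    slack-balanced : ∀ e → (if core (tail e) then 0ℚ else slack e) ≡ (if core (head e) then 0ℚ else slack e)
    slack-balanced = sum-tight pointwise (begin
      Sumℚ.sum (λ e → if core (tail e) then 0ℚ else slack e)
        ≡⟨ Outℚ.handshake _ ⟩
      Outℚ.sumV (Outℚ.flow (λ e → if core (tail e) then 0ℚ else slack e))
        ≡⟨ Outℚ.sumV-cong (λ v → trans (Outℚ.flow-unless core slack v)
             (trans (unless v) (sym (Inℚ.flow-unless core slack v)))) ⟩
      Inℚ.sumV (Inℚ.flow (λ e → if core (head e) then 0ℚ else slack e))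
        ≡⟨ Inℚ.handshake _ ⟨
      Sumℚ.sum (λ e → if core (head e) then 0ℚ else slack e)
        ∎)
      where
      open ≡-Reasoning
      0≤slack : ∀ e → 0ℚ ≤ slack e
      0≤slack e = subst (_≤ slack e) (ℚ.+-inverseʳ (t e)) (ℚ.+-monoˡ-≤ (ℚ.- t e) (t≤1 e))

      pointwise : ∀ e → (if core (tail e) then 0ℚ else slack e) ≤ (if core (head e) then 0ℚ else slack e)
      pointwise e with core (tail e) in c | core (head e) in c′
      ... | true  | true  = ℚ.≤-refl
      ... | true  | false = 0≤slack e
      ... | false | true  = ℚ.≤-reflexive (cong (1ℚ -_) (entering-core e c c′))
      ... | false | false = ℚ.≤-refl

      unless : ∀ v → (if core v then 0ℚ else Outℚ.flow slack v) ≡ (if core v then 0ℚ else Inℚ.flow slack v)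
      unless (inj₁ _)        = refl
      unless (inj₂ (inj₁ s)) = cong (if core (splitter s) then 0ℚ else_) (sym (slack-conserved s))
      unless (inj₂ (inj₂ _)) = refl

    -- An arc out of the core would have zero slack by `slack-balanced`, against `leaving-core`.
    -- Hence a walk from an input stays in the core.
    core-closed : ∀ e → core (tail e) ≡ true → core (head e) ≡ true
    core-closed e c with core (head e) | slack-balanced e
    ... | true  | _ = refl
    ... | false | balanced = contradiction (leaving-core e c) (ℚ.<-irrefl t≡1)
      where
      t≡1 : t e ≡ 1ℚ
      t≡1 = begin
        t e             ≡⟨ ℚ.+-identityˡ (t e) ⟨
        0ℚ + t e        ≡⟨ cong (λ b → (if b then 0ℚ else slack e) + t e) c ⟨
        _               ≡⟨ cong (_+ t e) balanced ⟩
        slack e + t e   ≡⟨ slack+t e ⟩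
        1ℚ              ∎
        where open ≡-Reasoning

    -- The arc also ends in the core, where a saturated arc would be full, against `leaving-core`.
    fluid-core : ∀ e → core (tail e) ≡ true → F e ≡ true
    fluid-core e c with F e in f
    ... | true  = refl
    ... | false = contradiction (leaving-core e c) (ℚ.<-irrefl (saturated-into-core e (core-closed e c) f))

    -- Domination of the walk by the throughput in the core.

    coreFlow : Arc → ℚ
    coreFlow e = if core (tail e) then t e else 0ℚ

    0≤coreFlow : ∀ e → 0ℚ ≤ coreFlow e
    0≤coreFlow e with core (tail e)
    ... | true  = 0≤t e
    ... | false = ℚ.≤-refl

    coreFlow≤t : ∀ e → coreFlow e ≤ t e
    coreFlow≤t e with core (tail e)
    ... | true  = ℚ.≤-refl
    ... | false = 0≤t e

    coreFlow-in : ∀ e → core (tail e) ≡ true → coreFlow e ≡ t e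
    coreFlow-in e c = cong (if_then t e else 0ℚ) c

    -- In the core every outgoing arc is fluid, hence a largest one by R7, and conservation gives it
    -- at least half of the inflow. Outside, no arc from the core arrives, by `core-closed`, so the
    -- left side is zero.
    coreFlow-super : ∀ s e → tail e ≡ splitter s → Inℚ.flow coreFlow (splitter s) ≤ coreFlow e + coreFlow e
    coreFlow-super s e h with core (splitter s) in c
    ... | true = begin
        Inℚ.flow coreFlow (splitter s)
          ≤⟨ Sumℚ.flow-mono head (splitter s) (λ e′ _ → coreFlow≤t e′) ⟩
        Inℚ.flow t (splitter s)
          ≡⟨ conserved s ⟩
        Outℚ.flow t (splitter s)
          ≤⟨ Sumℚ.flow-mono tail (splitter s) (λ e′ h′ → below-fluid s e e′ h h′ (fluid-core e ce)) ⟩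
        Outℚ.flow (const (t e)) (splitter s)
          ≡⟨ Degℚ.flow-const tail (t e) (splitter s) ⟩
        degree tail (splitter s) ·ℚ t e
          ≡⟨ cong (_·ℚ t e) (outdegˢ s) ⟩
        t e + (t e + 0ℚ)
          ≡⟨ cong (t e +_) (ℚ.+-identityʳ (t e)) ⟩
        t e + t e
          ≡⟨ cong₂ _+_ (coreFlow-in e ce) (coreFlow-in e ce) ⟨
        coreFlow e + coreFlow e ∎
      where
      open ℚ.≤-Reasoning
      ce : core (tail e) ≡ true
      ce = trans (cong core h) c
    ... | false = begin
        Inℚ.flow coreFlow (splitter s)       ≡⟨ Degℚ.flow-const-on head (splitter s) outside ⟩
        degree head (splitter s) ·ℚ 0ℚ       ≡⟨ cong (_·ℚ 0ℚ) (indegˢ s) ⟩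
        0ℚ                                   ≤⟨ ℚ.+-mono-≤ (0≤coreFlow e) (0≤coreFlow e) ⟩
        coreFlow e + coreFlow e              ∎
      where
      open ℚ.≤-Reasoning
      outside : ∀ e′ → head e′ ≡ splitter s → coreFlow e′ ≡ 0ℚ
      outside e′ h′ with core (tail e′) in c′
      ... | true  = contradiction (trans (sym (core-closed e′ c′)) (trans (cong core h′) c)) λ ()
      ... | false = refl

    -- Induction along the walk: the scale doubles at each step, while by `coreFlow-super` an arc
    -- keeps at least half of the core flow into its splitter. Unscaled, expected traversals are at
    -- most twice `coreFlow`.
    visits≤coreFlow : ∀ k e → ℕ→ℚ (visits i k e) ≤ ℕ→ℚ (2 ^ k) * coreFlow e
    visits≤coreFlow zero e = ℚ.≤-trans (0≤coreFlow e) (ℚ.≤-reflexive (sym (ℚ.*-identityˡ (coreFlow e))))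
    visits≤coreFlow (suc k) e = at (tail e) refl
      where
      open ℚ.≤-Reasoning
      double : ∀ x → ℕ→ℚ (2 ^ k) * (x + x) ≡ ℕ→ℚ (2 ^ suc k) * x
      double x = trans
        (solve 2 (λ a x → a :* (x :+ x) := (con (ℕ→ℚ 2) :* a) :* x) refl (ℕ→ℚ (2 ^ k)) x)
        (cong (_* x) (sym (ℕ→ℚ-* 2 (2 ^ k))))
        where open ℚ.+-*-Solver

      at : ∀ v → tail e ≡ v → ℕ→ℚ (Sumℕ.when (v ≟V input i) (2 ^ k) ℕ.+ Inℕ.flow (visits i k) v)
                              ≤ ℕ→ℚ (2 ^ suc k) * coreFlow e
      at (inj₁ j) h rewrite Degℕ.flow-none head (visits i k) (indegᴵ j)
        with j Fin.≟ i
      ... | no _ = ℚ.≤-trans (ℚ.≤-reflexive (sym (ℚ.*-zeroʳ (ℕ→ℚ (2 ^ suc k)))))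
                     (ℚ.*-monoˡ-≤-nonNeg (ℕ→ℚ (2 ^ suc k)) {{ℕ→ℚ-nonNeg (2 ^ suc k)}} (0≤coreFlow e))
      -- The arc leaving the pulsed input is fluid by `fluid-core`, so R3 makes its throughput
      -- exactly ½.
      ... | yes refl = ℚ.≤-reflexive (begin-equality
        ℕ→ℚ (2 ^ k ℕ.+ 0)             ≡⟨ cong ℕ→ℚ (ℕ.+-identityʳ (2 ^ k)) ⟩
        ℕ→ℚ (2 ^ k)                   ≡⟨ ℚ.*-identityʳ (ℕ→ℚ (2 ^ k)) ⟨
        ℕ→ℚ (2 ^ k) * (½ + ½)         ≡⟨ double ½ ⟩
        ℕ→ℚ (2 ^ suc k) * ½           ≡⟨ cong (ℕ→ℚ (2 ^ suc k) *_) (Sumℚ.when-true (i Fin.≟ i) refl) ⟨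
        ℕ→ℚ (2 ^ suc k) * pulse i i      ≡⟨ cong (ℕ→ℚ (2 ^ suc k) *_) (proj₂ (R3 i e h) (fluid-core e ce)) ⟨
        ℕ→ℚ (2 ^ suc k) * t e         ≡⟨ cong (ℕ→ℚ (2 ^ suc k) *_) (coreFlow-in e ce) ⟨
        ℕ→ℚ (2 ^ suc k) * coreFlow e  ∎)
        where
        ce : core (tail e) ≡ true
        ce = cong core h
      at (inj₂ (inj₁ s)) h = begin
        ℕ→ℚ (Inℕ.flow (visits i k) (splitter s))
          ≡⟨ flow-homo ℕ.+-0-isCommutativeMonoid ℚ.+-0-isCommutativeMonoid ℕ→ℚ refl ℕ→ℚ-+ head (visits i k) (splitter s) ⟩
        Inℚ.flow (ℕ→ℚ ∘ visits i k) (splitter s)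
          ≤⟨ Sumℚ.flow-mono head (splitter s) (λ e′ _ → visits≤coreFlow k e′) ⟩
        Inℚ.flow (λ e′ → ℕ→ℚ (2 ^ k) * coreFlow e′) (splitter s)
          ≡⟨ flow-homo ℚ.+-0-isCommutativeMonoid ℚ.+-0-isCommutativeMonoid (ℕ→ℚ (2 ^ k) *_)
               (ℚ.*-zeroʳ (ℕ→ℚ (2 ^ k))) (ℚ.*-distribˡ-+ (ℕ→ℚ (2 ^ k))) head coreFlow (splitter s) ⟨
        ℕ→ℚ (2 ^ k) * Inℚ.flow coreFlow (splitter s)
          ≤⟨ ℚ.*-monoˡ-≤-nonNeg (ℕ→ℚ (2 ^ k)) {{ℕ→ℚ-nonNeg (2 ^ k)}} (coreFlow-super s e h) ⟩
        ℕ→ℚ (2 ^ k) * (coreFlow e + coreFlow e)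
          ≡⟨ double (coreFlow e) ⟩
        ℕ→ℚ (2 ^ suc k) * coreFlow e ∎
      at (inj₂ (inj₂ o)) h = contradiction h (degree≡0⇒≢ tail (outdegᴼ o) e)

    -- Throughput and visits at the outputs.

    output-total : Sumℚ.sum (Inℚ.flow t ∘ output) ≡ Sumℚ.sum (Outℚ.flow t ∘ input)
    -- Counted by heads and by tails, `t` has the same total; by R5 the splitters contribute `Z` to
    -- both counts.
    output-total = Group.∙-cancelˡ ℚ.+-0-group Z _ _ (begin
      Z + Sumℚ.sum (Inℚ.flow t ∘ output)
        ≡⟨ ℚ.+-identityˡ _ ⟨
      0ℚ + (Z + Sumℚ.sum (Inℚ.flow t ∘ output))
        ≡⟨ cong (_+ (Z + Sumℚ.sum (Inℚ.flow t ∘ output))) (Sumℚ.sum-ε λ j → Degℚ.flow-none head t (indegᴵ j)) ⟨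
      Inℚ.sumV (Inℚ.flow t)
        ≡⟨ Inℚ.handshake t ⟨
      Sumℚ.sum t
        ≡⟨ Outℚ.handshake t ⟩
      Outℚ.sumV (Outℚ.flow t)
        ≡⟨ cong (Sumℚ.sum (Outℚ.flow t ∘ input) +_) (cong₂ _+_ (Sumℚ.sum-cong λ s → sym (conserved s))
             (Sumℚ.sum-ε λ o → Degℚ.flow-none tail t (outdegᴼ o))) ⟩
      Sumℚ.sum (Outℚ.flow t ∘ input) + (Z + 0ℚ)
        ≡⟨ cong (Sumℚ.sum (Outℚ.flow t ∘ input) +_) (ℚ.+-identityʳ Z) ⟩
      Sumℚ.sum (Outℚ.flow t ∘ input) + Z
        ≡⟨ ℚ.+-comm _ Z ⟩
      Z + Sumℚ.sum (Outℚ.flow t ∘ input)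
        ∎)
      where
      open ≡-Reasoning
      Z = Sumℚ.sum (Inℚ.flow t ∘ splitter)

    module _ (constant : ConstantOnOutputs G t) where

      -- Constancy makes the total output `nO` copies of `t e`; by `output-total` this is what
      -- leaves the inputs, at most the ½ of the pulse.
      output-share : ∀ o e → head e ≡ output o → ℕ→ℚ nO * t e ≤ ½
      output-share o e h = begin
        ℕ→ℚ nO * t e                           ≡⟨ ·ℚ≡* nO (t e) ⟨
        nO ·ℚ t e                              ≡⟨ Sumℚ.sum-const {nO} (t e) ⟨
        Sumℚ.sum {nO} (const (t e))            ≡⟨ Sumℚ.sum-cong (λ o′ → sym (share o′)) ⟩
        Sumℚ.sum (Inℚ.flow t ∘ output)         ≡⟨ output-total ⟩
        Sumℚ.sum (Outℚ.flow t ∘ input)         ≤⟨ Sumℚ.sum-mono supply ⟩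
        Sumℚ.sum (pulse i)                           ≡⟨ Sumℚ.sum-when-≟ i ½ ⟩
        ½                                      ∎
        where
        open ℚ.≤-Reasoning
        share : ∀ o′ → Inℚ.flow t (output o′) ≡ t e
        share o′ = begin-equality
          Inℚ.flow t (output o′)               ≡⟨ Degℚ.flow-const-on head (output o′) (λ e′ h′ → constant o′ o e′ e h′ h) ⟩
          degree head (output o′) ·ℚ t e       ≡⟨ cong (_·ℚ t e) (indegᴼ o′) ⟩
          t e + 0ℚ                             ≡⟨ ℚ.+-identityʳ (t e) ⟩
          t e                                  ∎
        supply : ∀ j → Outℚ.flow t (input j) ≤ pulse i j
        supply j = begin
          Outℚ.flow t (input j)                ≤⟨ Sumℚ.flow-mono tail (input j) (λ e′ h′ → proj₁ (R3 j e′ h′)) ⟩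
          Outℚ.flow (const (pulse i j)) (input j)  ≡⟨ Degℚ.flow-const tail (pulse i j) (input j) ⟩
          degree tail (input j) ·ℚ pulse i j       ≡⟨ cong (_·ℚ pulse i j) (outdegᴵ j) ⟩
          pulse i j + 0ℚ                           ≡⟨ ℚ.+-identityʳ (pulse i j) ⟩
          pulse i j                                ∎

      -- The ½ of `output-share` cancels the extra factor 2 of `visits≤coreFlow`. For the walk: the
      -- output is reached within k + 1 arcs with probability at most 1/`nO`.
      visits-at-output : ∀ k o e → head e ≡ output o → nO ℕ.* visits i (suc k) e ℕ.≤ 2 ^ k
      visits-at-output k o e h = ℕ→ℚ-cancel-≤ (begin
        ℕ→ℚ (nO ℕ.* visits i (suc k) e)
          ≡⟨ ℕ→ℚ-* nO (visits i (suc k) e) ⟩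
        ℕ→ℚ nO * ℕ→ℚ (visits i (suc k) e)
          ≤⟨ ℚ.*-monoˡ-≤-nonNeg (ℕ→ℚ nO) {{ℕ→ℚ-nonNeg nO}} (visits≤coreFlow (suc k) e) ⟩
        ℕ→ℚ nO * (ℕ→ℚ (2 ^ suc k) * coreFlow e)
          ≤⟨ ℚ.*-monoˡ-≤-nonNeg (ℕ→ℚ nO) {{ℕ→ℚ-nonNeg nO}}
               (ℚ.*-monoˡ-≤-nonNeg (ℕ→ℚ (2 ^ suc k)) {{ℕ→ℚ-nonNeg (2 ^ suc k)}} (coreFlow≤t e)) ⟩
        ℕ→ℚ nO * (ℕ→ℚ (2 ^ suc k) * t e)
          ≡⟨ solve 3 (λ n x t → n :* (x :* t) := x :* (n :* t)) refl (ℕ→ℚ nO) (ℕ→ℚ (2 ^ suc k)) (t e) ⟩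
        ℕ→ℚ (2 ^ suc k) * (ℕ→ℚ nO * t e)
          ≤⟨ ℚ.*-monoˡ-≤-nonNeg (ℕ→ℚ (2 ^ suc k)) {{ℕ→ℚ-nonNeg (2 ^ suc k)}} (output-share o e h) ⟩
        ℕ→ℚ (2 ^ suc k) * ½
          ≡⟨ cong (_* ½) (ℕ→ℚ-* 2 (2 ^ k)) ⟩
        (ℕ→ℚ 2 * ℕ→ℚ (2 ^ k)) * ½
          ≡⟨ solve 3 (λ a x b → (a :* x) :* b := x :* (a :* b)) refl (ℕ→ℚ 2) (ℕ→ℚ (2 ^ k)) ½ ⟩
        ℕ→ℚ (2 ^ k) * 1ℚ
          ≡⟨ ℚ.*-identityʳ (ℕ→ℚ (2 ^ k)) ⟩
        ℕ→ℚ (2 ^ k) ∎)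
        where
        open ℚ.≤-Reasoning
        open ℚ.+-*-Solver


-- The Knuth-Yao estimate and the final count.

open Remainders

module _ {nI nS q} (G : Digraph nI nS (suc q)) (network : IsSplitterNetwork G) (balancer : IsBalancer G) where
  open Digraph G
  open Network G network

  -- The scaled count is a natural number, so its bound 2^k/p can be rounded down; this rounding
  -- produces the remainders.
  output-visits : ∀ i k o → Inℕ.flow (visits i (suc k)) (output o) ℕ.≤ 2 ^ k / suc q
  output-visits i k o = begin
    Inℕ.flow (visits i (suc k)) (output o)
      ≤⟨ Sumℕ.flow-mono head (output o) atArc ⟩
    Inℕ.flow (const (2 ^ k / suc q)) (output o)
      ≡⟨ Degℕ.flow-const head _ (output o) ⟩
    degree head (output o) ·ℕ (2 ^ k / suc q)
      ≡⟨ trans (cong (_·ℕ (2 ^ k / suc q)) (indegᴼ o)) (ℕ.+-identityʳ (2 ^ k / suc q)) ⟩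
    2 ^ k / suc q ∎
    where
    open ℕ.≤-Reasoning
    atArc : ∀ e → head e ≡ output o → visits i (suc k) e ℕ.≤ 2 ^ k / suc q
    -- The balancing property enters here, through a steady state for the pulse at `i`.
    atArc e h with balancer (pulse i) (λ j → 0≤pulse i j , ℚ.≤-trans (pulse≤½ i j) (ℚ.<⇒≤ ½<1))
    ... | t , F , steady , constant = begin
      V                       ≡⟨ m*n/n≡m V (suc q) ⟨
      V ℕ.* suc q / suc q     ≤⟨ /-monoˡ-≤ (suc q) (subst (ℕ._≤ 2 ^ k) (ℕ.*-comm (suc q) V)
                                   (Steady.visits-at-output G network i steady constant k o e h)) ⟩
      2 ^ k / suc q           ∎
      where V = visits i (suc k) e

  -- By `load-suc`, the next load is twice the old one plus 2^k, less what the outputs absorb, which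
  -- is at most p times the floor of 2^k/p. What remains of 2^k is the remainder that `remainderSum`
  -- adds.
  remainderSum≤load : ∀ i k → remainderSum q k ℕ.≤ load i k
  remainderSum≤load i zero = ℕ.z≤n
  remainderSum≤load i (suc k) = ℕ.+-cancelʳ-≤ (Q ℕ.* suc q) _ _ (begin
    2 ℕ.* remainderSum q k ℕ.+ r ℕ.+ Q ℕ.* suc q
      ≡⟨ ℕ.+-assoc (2 ℕ.* remainderSum q k) r (Q ℕ.* suc q) ⟩
    2 ℕ.* remainderSum q k ℕ.+ (r ℕ.+ Q ℕ.* suc q)
      ≡⟨ cong (2 ℕ.* remainderSum q k ℕ.+_) (m≡m%n+[m/n]*n (2 ^ k) (suc q)) ⟨
    2 ℕ.* remainderSum q k ℕ.+ 2 ^ k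
      ≤⟨ ℕ.+-monoˡ-≤ (2 ^ k) (ℕ.*-monoʳ-≤ 2 (remainderSum≤load i k)) ⟩
    2 ℕ.* load i k ℕ.+ 2 ^ k
      ≡⟨ ℕ.+-comm (2 ℕ.* load i k) (2 ^ k) ⟩
    2 ^ k ℕ.+ 2 ℕ.* load i k
      ≡⟨ load-suc i k ⟨
    load i (suc k) ℕ.+ Sumℕ.sum (λ o → Inℕ.flow (visits i (suc k)) (output o))
      ≤⟨ ℕ.+-monoʳ-≤ (load i (suc k)) (Sumℕ.sum-mono (output-visits i k)) ⟩
    load i (suc k) ℕ.+ Sumℕ.sum {suc q} (const Q)
      ≡⟨ cong (load i (suc k) ℕ.+_) (trans (Sumℕ.sum-const {suc q} Q) (·ℕ≡* (suc q) Q)) ⟩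
    load i (suc k) ℕ.+ suc q ℕ.* Q
      ≡⟨ cong (load i (suc k) ℕ.+_) (ℕ.*-comm (suc q) Q) ⟩
    load i (suc k) ℕ.+ Q ℕ.* suc q ∎)
    where
    open ℕ.≤-Reasoning
    Q = 2 ^ k / suc q
    r = 2 ^ k % suc q

  -- The total load is estimated from both sides. One factor 2 stems from the summation by parts,
  -- the other from `total-load`.
  scaled-bound : ∀ k → nI ℕ.* suc q ℕ.* scaledSeries (suc q) k ℕ.≤ 4 ℕ.* nS ℕ.* 2 ^ k
  scaled-bound k = begin
    nI ℕ.* suc q ℕ.* scaledSeries (suc q) k
      ≡⟨ ℕ.*-assoc nI (suc q) (scaledSeries (suc q) k) ⟩
    nI ℕ.* (suc q ℕ.* scaledSeries (suc q) k)
      ≤⟨ ℕ.*-monoʳ-≤ nI (scaledSeries≤2*remainderSum q k) ⟩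
    nI ℕ.* (2 ℕ.* remainderSum q k)
      ≡⟨ solve 2 (λ n x → n :* (con 2 :* x) := con 2 :* (n :* x)) refl nI (remainderSum q k) ⟩
    2 ℕ.* (nI ℕ.* remainderSum q k)
      ≡⟨ cong (2 ℕ.*_) (trans (Sumℕ.sum-const {nI} (remainderSum q k)) (·ℕ≡* nI (remainderSum q k))) ⟨
    2 ℕ.* Sumℕ.sum {nI} (const (remainderSum q k))
      ≤⟨ ℕ.*-monoʳ-≤ 2 (ℕ.≤-trans (Sumℕ.sum-mono (λ i → remainderSum≤load i k)) (total-load k)) ⟩
    2 ℕ.* (nS ℕ.* 2 ^ suc k)
      ≡⟨ solve 2 (λ s x → con 2 :* (s :* (con 2 :* x)) := con 4 :* s :* x) refl nS (2 ^ k) ⟩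
    4 ℕ.* nS ℕ.* 2 ^ k ∎
    where
    open ℕ.≤-Reasoning
    open +-*-Solver

-- The terms of the series are nonnegative, so a bound on every partial sum is a bound on the
-- series.
theorem4 : ∀ {nI nS nO : ℕ} (G : Digraph nI nS nO) →
    IsSplitterNetwork G → IsBalancer G →
    (N : ℕ) → ℕ→ℚ nI * ℕ→ℚ nO * partialSeries nO N ≤ ℕ→ℚ 4 * ℕ→ℚ nS
theorem4 {nI} {nS} {zero} G network balancer N = begin
  ℕ→ℚ nI * 0ℚ * partialSeries 0 N  ≡⟨ cong (_* partialSeries 0 N) (ℚ.*-zeroʳ (ℕ→ℚ nI)) ⟩
  0ℚ * partialSeries 0 N           ≡⟨ ℚ.*-zeroˡ (partialSeries 0 N) ⟩
  ℕ→ℚ 0                            ≤⟨ ℕ→ℚ-mono-≤ {0} {4 ℕ.* nS} ℕ.z≤n ⟩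
  ℕ→ℚ (4 ℕ.* nS)                   ≡⟨ ℕ→ℚ-* 4 nS ⟩
  ℕ→ℚ 4 * ℕ→ℚ nS                   ∎
  where open ℚ.≤-Reasoning
theorem4 {nI} {nS} {suc q} G network balancer N = begin
  ℕ→ℚ nI * ℕ→ℚ p * partialSeries p N
    ≡⟨ cong₂ _*_ (sym (ℕ→ℚ-* nI p)) (partialSeries≡scaledSeries p N) ⟩
  ℕ→ℚ (nI ℕ.* p) * (ℕ→ℚ s * halfPow N)
    ≡⟨ ℚ.*-assoc (ℕ→ℚ (nI ℕ.* p)) (ℕ→ℚ s) (halfPow N) ⟨
  ℕ→ℚ (nI ℕ.* p) * ℕ→ℚ s * halfPow N
    ≡⟨ cong (_* halfPow N) (ℕ→ℚ-* (nI ℕ.* p) s) ⟨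
  ℕ→ℚ (nI ℕ.* p ℕ.* s) * halfPow N
    ≤⟨ ℚ.*-monoʳ-≤-nonNeg (halfPow N) {{halfPow-nonNeg N}} (ℕ→ℚ-mono-≤ (scaled-bound G network balancer N)) ⟩
  ℕ→ℚ (4 ℕ.* nS ℕ.* 2 ^ N) * halfPow N
    ≡⟨ cong (_* halfPow N) (ℕ→ℚ-* (4 ℕ.* nS) (2 ^ N)) ⟩
  ℕ→ℚ (4 ℕ.* nS) * ℕ→ℚ (2 ^ N) * halfPow N
    ≡⟨ ℚ.*-assoc (ℕ→ℚ (4 ℕ.* nS)) (ℕ→ℚ (2 ^ N)) (halfPow N) ⟩
  ℕ→ℚ (4 ℕ.* nS) * (ℕ→ℚ (2 ^ N) * halfPow N)
    ≡⟨ cong₂ _*_ (ℕ→ℚ-* 4 nS) (2^n*½^n≡1 N) ⟩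
  ℕ→ℚ 4 * ℕ→ℚ nS * 1ℚ
    ≡⟨ ℚ.*-identityʳ (ℕ→ℚ 4 * ℕ→ℚ nS) ⟩
  ℕ→ℚ 4 * ℕ→ℚ nS ∎
  where
  open ℚ.≤-Reasoning
  p = suc q
  s = scaledSeries p N
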